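{- For every positive integer $n$, $$E_0(n)=E_1(n)=\frac{\overline{p}_o(n)}{2}.$$
   Context: A two-color partition of $n$ is a finite multiset of positive integers (parts), each part carrying one of the two colors red or blue, whose numerical values sum to $n$; copies of the same integer in different colors are regarded as different parts. Let $\mathcal E(n)$ be the set of two-color partitions of $n$ in which parts are distinct (each colored part occurs at most once, so an odd integer may occur once in red and once in blue) and even parts may occur only in blue. Equivalently, $\sum_{n\ge0}|\mathcal E(n)|q^n=\prod_{k\ge1}(1+q^{2k-1})^2(1+q^{2k})$. For $\lambda\in\mathcal E(n)$, let $r(\lambda)$ be the number of red odd parts of $\lambda$. Define $\mathcal E_0(n)=\{\lambda\in\mathcal E(n): r(\lambda)\equiv 0\pmod 2\}$ and $\mathcal E_1(n)=\{\lambda\in\mathcal E(n): r(\lambda)\equiv 1\pmod 2\}$, and let $E_i(n)=|\mathcal E_i(n)|$ for $i=0,1$. An overpartition of $n$ is a partition of $n$ in which the first occurrence of each distinct part may be overlined. $\overline p_o(n)$ denotes the number of overpartitions of $n$ into odd parts, i.e. those in which the overlined parts are distinct odd integers and the non-overlined parts are unrestricted odd integers; $\sum_{n\ge0}\overline p_o(n)q^n=\prod_{k\ge1}\frac{1+q^{2k-1}}{1-q^{2k-1}}$. -}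

module Defs where

open import Data.Fin.Base using (Fin)
open import Data.List.Base using (List; sum; length; filter)
open import Data.List.Relation.Unary.All using (All)
open import Data.List.Relation.Unary.Linked using (Linked)
open import Data.List.Relation.Unary.Unique.Propositional using (Unique)
open import Data.Nat.Base using (ℕ; _+_; _%_; _<_; _≥_)
open import Data.Nat.Divisibility using (_∣_; _∣?_)
open import Data.Product.Base using (_×_)
open import Data.Refinement using (Refinement-syntax; value)
open import Function.Bundles using (_↔_)
open import Relation.Binary.PropositionalEquality using (_≡_)
open import Relation.Nullary using (¬_)
open import Relation.Nullary.Decidable using (¬?)
open import Relation.Unary using (Decidable)

-- Subsets are refinement types: the proof component is irrelevant, so two
-- elements are equal exactly when their values are, and counting elements up
-- to _≡_ counts each object once.

HasCardinality : Set → ℕ → Set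
HasCardinality A k = A ↔ Fin k

Even Odd : ℕ → Set
Even k = 2 ∣ k
Odd k = ¬ Even k

odd? : Decidable Odd
odd? k = ¬? (2 ∣? k)

-- A finite multiset of positive integers, represented by its unique
-- nonincreasing listing.
Partition : Set
Partition = [ ks ∈ List ℕ ∣ Linked _≥_ ks × All (0 <_) ks ]

parts : Partition → List ℕ
parts = value

-- Copies of an integer in different colours are different parts, so a multiset
-- of coloured positive integers is given by the multiset of its red parts and
-- the multiset of its blue parts.
record TwoColourPartition : Set where
  constructor mkTwoColour
  field
    red blue : Partition

  redParts blueParts : List ℕ
  redParts = parts red
  blueParts = parts blue

  size : ℕ
  size = sum redParts + sum blueParts

  redOddCount : ℕ
  redOddCount = length (filter odd? redParts)

record InE (n : ℕ) (π : TwoColourPartition) : Set where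
  open TwoColourPartition π
  field
    size≡n       : size ≡ n
    redDistinct  : Unique redParts
    blueDistinct : Unique blueParts
    noEvenRed    : All (λ k → ¬ Even k) redParts

𝓔 : ℕ → Set
𝓔 n = [ π ∈ TwoColourPartition ∣ InE n π ]

r : ∀ {n} → 𝓔 n → ℕ
r π = TwoColourPartition.redOddCount (value π)

𝓔₀ 𝓔₁ : ℕ → Set
𝓔₀ n = [ π ∈ 𝓔 n ∣ r π % 2 ≡ 0 ]
𝓔₁ n = [ π ∈ 𝓔 n ∣ r π % 2 ≡ 1 ]

-- Since only the first occurrence of each distinct part may be overlined, the
-- overlined parts are distinct, while the non-overlined ones form an arbitrary
-- partition; these two pieces determine the overpartition.
record MarkedPartition : Set where
  constructor mkMarked
  field
    overlined plain : Partition

  overlinedParts plainParts : List ℕ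
  overlinedParts = parts overlined
  plainParts = parts plain

  size : ℕ
  size = sum overlinedParts + sum plainParts

Overpartition : Set
Overpartition = [ π ∈ MarkedPartition ∣ Unique (MarkedPartition.overlinedParts π) ]

record IsOddOverpartitionOf (n : ℕ) (π : Overpartition) : Set where
  open MarkedPartition (value π)
  field
    size≡n       : size ≡ n
    overlinedOdd : All Odd overlinedParts
    plainOdd     : All Odd plainParts

OddOverpartition : ℕ → Set
OddOverpartition n = [ π ∈ Overpartition ∣ IsOddOverpartitionOf n π ]

{-# OPTIONS --safe #-}
-- Glaisher's bijection turns the distinct blue parts into an arbitrary multiset
-- of odd parts, so 𝓔 n corresponds to the odd overpartitions of n, with the red
-- parts as the overlined ones. For n > 0, changing the overlining of (one copy
-- of) the largest part is an involution that flips the parity of the number of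
-- overlined parts, so both parities account for half of the overpartitions.

module Submission where

open import Defs
open import Data.Nat.Base using (ℕ; _*_; _<_)
open import Data.Product.Base using (∃-syntax; _×_)
open import Relation.Binary.PropositionalEquality using (_≡_)

open import Data.Empty using (⊥)
open import Data.Fin.Base using (Fin; zero; suc)
open import Data.Fin.Properties using (+↔⊎)
open import Data.Irrelevant using ([_])
open import Data.List.Base
  using (List; []; _∷_; _++_; map; filter; length; lookup; upTo; deduplicate; cartesianProduct; cartesianProductWith)
open import Data.List.Membership.Propositional using (_∈_; _∉_)
open import Data.List.Membership.Propositional.Properties
  using (∈-∃++; ∈-map⁻; ∈-cartesianProduct⁺; ∈-cartesianProductWith⁺; ∈-deduplicate⁺; ∈-filter⁺; ∈-filter⁻; ∈-lookup; ∈-upTo⁺)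
open import Data.List.Properties
  using (length-++; filter-++; filter-all; filter-none; filter-accept; filter-reject; map-∘; map-id-local; ++-identityʳ)
  renaming (≡-dec to ≡-decˡ)
open import Data.List.Relation.Binary.Permutation.Propositional
  using (_↭_; prep; ↭-refl; ↭-reflexive; ↭-sym; ↭-trans; ↭⇒↭ₛ; module PermutationReasoning)
open import Data.List.Relation.Binary.Permutation.Propositional.Properties
  using (All-resp-↭; ↭-length; filter-↭; shift; map⁺; ++⁺; ++⁺ˡ; ++⁺ʳ)
import Data.List.Relation.Binary.Pointwise as Pointwise
open import Data.List.Relation.Unary.All as All using (All; []; _∷_)
import Data.List.Relation.Unary.All.Properties as All
open import Data.List.Relation.Unary.AllPairs using ([]; _∷_)
open import Data.List.Relation.Unary.Any using (here; there; index)
open import Data.List.Relation.Unary.Any.Properties using (lookup-index)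
open import Data.List.Relation.Unary.Linked as Linked using (Linked; []; [-]; _∷_)
open import Data.List.Relation.Unary.Linked.Properties using (Linked⇒All)
open import Data.List.Relation.Unary.Sorted.TotalOrder.Properties using (↗↭↗⇒≋)
open import Data.List.Relation.Unary.Unique.DecPropositional.Properties using (deduplicate-!)
open import Data.List.Relation.Unary.Unique.Propositional using (Unique)
import Data.List.Relation.Unary.Unique.Propositional.Properties as Unique
open import Data.Nat.Base using (zero; suc; _+_; _≤_; _≥_; _/_; _%_; z≤n; s≤s)
open import Data.Nat.Divisibility using (_∣?_; divides; n∣m*n)
open import Data.Nat.DivMod using (m*n/n≡m)
open import Data.Nat.ListAction using (sum)
open import Data.Nat.ListAction.Properties using (sum-++; sum-↭)
open import Data.Nat.Properties
open import Data.List.Membership.DecPropositional _≟_ using (_∈?_)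
open import Data.List.Relation.Unary.Unique.DecPropositional _≟_ using (unique?)
open import Relation.Binary.Properties.DecTotalOrder ≤-decTotalOrder using (≥-decTotalOrder; ≥-totalOrder)
open import Data.List.Sort ≥-decTotalOrder using (sort; sort-↭; sort-↗)
open import Data.Product.Base using (_,_; proj₁; proj₂)
open import Data.Product.Properties using () renaming (≡-dec to ≡-decˣ)
open import Data.Refinement using (Refinement; Refinement-syntax; value; value-injective; _,_)
open import Data.Sum.Base using (_⊎_; inj₁; inj₂)
open import Data.Sum.Function.Propositional using (_⊎-↔_)
open import Function.Base using (_∘_)
open import Function.Bundles using (_↔_; mk↔ₛ′)
open import Function.Construct.Composition using (_↔-∘_)
open import Function.Related.Propositional using (module EquationalReasoning)
open import Relation.Binary.Definitions using (DecidableEquality)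
open import Relation.Binary.PropositionalEquality using (refl; sym; trans; cong; cong₂; subst; module ≡-Reasoning)
open import Relation.Nullary using (yes; no; contradiction)
open import Relation.Nullary.Decidable using (¬?; _×-dec_; recompute)
open import Relation.Nullary.Negation using (contradiction-irr)
open import Relation.Unary using (Decidable)

-- Multiplicities

count : ℕ → List ℕ → ℕ
count x xs = length (filter (x ≟_) xs)

count-++ : ∀ x xs ys → count x (xs ++ ys) ≡ count x xs + count x ys
count-++ x xs ys = trans (cong length (filter-++ (x ≟_) xs ys)) (length-++ (filter (x ≟_) xs))

count-↭ : ∀ {xs ys} x → xs ↭ ys → count x xs ≡ count x ys
count-↭ x xs↭ys = ↭-length (filter-↭ (x ≟_) xs↭ys)

count-here : ∀ x xs → count x (x ∷ xs) ≡ suc (count x xs)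
count-here x xs = cong length (filter-accept (x ≟_) refl)

count-∉ : ∀ {x xs} → x ∉ xs → count x xs ≡ 0
count-∉ {x} x∉xs = cong length (filter-none (x ≟_) (All.¬Any⇒All¬ _ x∉xs))

count-Unique : ∀ {xs} x → Unique xs → count x xs ≤ 1
count-Unique x [] = z≤n
count-Unique {y ∷ xs} x u@(_ ∷ us) with x ≟ y
... | yes refl = ≤-reflexive (trans (count-here y xs) (cong suc (count-∉ (Unique.Unique[x∷xs]⇒x∉xs u))))
... | no x≢y = ≤-trans (≤-reflexive (cong length (filter-reject (x ≟_) x≢y))) (count-Unique x us)

∈⇒↭∷ : ∀ {x : ℕ} {xs} → x ∈ xs → ∃[ ys ] xs ↭ x ∷ ys
∈⇒↭∷ {x} x∈xs with as , bs , eq ← ∈-∃++ x∈xs =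
  as ++ bs , ↭-trans (↭-reflexive eq) (shift x as bs)

-- The head of `xs` has positive multiplicity, hence occurs in `ys`. Removing one copy from each
-- side lowers the same counts equally, so induction applies.
count-injective : ∀ xs ys → (∀ x → count x xs ≡ count x ys) → xs ↭ ys
count-injective [] [] _ = ↭-refl
count-injective [] (y ∷ ys) eq = contradiction (trans (eq y) (count-here y ys)) 0≢1+n
count-injective (x ∷ xs) ys eq with x ∈? ys
... | no x∉ys = contradiction (trans (sym (count-∉ x∉ys)) (trans (sym (eq x)) (count-here x xs))) 0≢1+n
... | yes x∈ys with zs , ys↭ ← ∈⇒↭∷ x∈ys =
  ↭-trans (prep x (count-injective xs zs eq′)) (↭-sym ys↭)
  where
  eq′ : ∀ y → count y xs ≡ count y zs
  eq′ y = +-cancelˡ-≡ (count y (x ∷ [])) _ _ (begin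
    count y (x ∷ []) + count y xs ≡⟨ count-++ y (x ∷ []) xs ⟨
    count y (x ∷ xs)           ≡⟨ eq y ⟩
    count y ys                 ≡⟨ count-↭ y ys↭ ⟩
    count y (x ∷ zs)           ≡⟨ count-++ y (x ∷ []) zs ⟩
    count y (x ∷ []) + count y zs ∎)
    where open ≡-Reasoning

-- Distinctness amounts to all multiplicities being at most 1, and multiplicities are invariant
-- under permutation.
Unique-resp-↭ : ∀ {xs ys : List ℕ} → xs ↭ ys → Unique xs → Unique ys
Unique-resp-↭ {xs} {ys} xs↭ys u = from-count ys λ x → ≤-trans (≤-reflexive (count-↭ x (↭-sym xs↭ys))) (count-Unique x u)
  where
  from-count : ∀ zs → (∀ x → count x zs ≤ 1) → Unique zs
  from-count [] _ = []
  from-count (z ∷ zs) c =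
    All.¬Any⇒All¬ zs (λ z∈zs → contradiction (c z) (<⇒≱ (subst (1 <_) (sym (count-here z zs)) (s≤s (occurs z∈zs)))))
      ∷ from-count zs λ x → ≤-trans (≤-trans (m≤n+m _ (count x (z ∷ []))) (≤-reflexive (sym (count-++ x (z ∷ []) zs)))) (c x)
    where
    occurs : z ∈ zs → 0 < count z zs
    occurs z∈zs with ws , zs↭ ← ∈⇒↭∷ z∈zs =
      subst (0 <_) (sym (trans (count-↭ z zs↭) (count-here z ws))) (s≤s z≤n)

-- Splitting a multiset into its elements of odd multiplicity and a doubled rest

record Split (xs : List ℕ) : Set where
  field
    single half : List ℕ
    single-unique : Unique single
    ↭-join        : xs ↭ single ++ half ++ half

-- Each new element toggles its membership in `single`: a second copy cancels the first, and the
-- pair is recorded once in `half`.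
split : ∀ xs → Split xs
split [] = record { single = []; half = []; single-unique = []; ↭-join = ↭-refl }
split (x ∷ xs) with split xs
... | record { single = s; half = p; single-unique = s! ; ↭-join = xs↭ } with x ∈? s
...   | no x∉s = record
        { single = x ∷ s; half = p; single-unique = All.¬Any⇒All¬ s x∉s ∷ s!; ↭-join = prep x xs↭ }
...   | yes x∈s with t , s↭ ← ∈⇒↭∷ x∈s with _ ∷ t! ← Unique-resp-↭ s↭ s! = record
        { single = t; half = x ∷ p; single-unique = t!; ↭-join = begin
            x ∷ xs                  ↭⟨ prep x xs↭ ⟩
            x ∷ s ++ p ++ p         ↭⟨ prep x (++⁺ʳ (p ++ p) s↭) ⟩
            x ∷ x ∷ t ++ p ++ p     ↭⟨ prep x (shift x t (p ++ p)) ⟨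
            x ∷ t ++ x ∷ p ++ p     ↭⟨ shift x t (x ∷ p ++ p) ⟨
            t ++ x ∷ x ∷ p ++ p     ↭⟨ ++⁺ˡ t (prep x (shift x p p)) ⟨
            t ++ x ∷ p ++ x ∷ p     ∎ }
  where open PermutationReasoning

-- Uniqueness of the last binary digit and the remaining quotient. Two units are peeled off both
-- sides at a time; if only one quotient is zero, its digit would have to be at least 2.
bit+double-injective : ∀ {b c} m n → b ≤ 1 → c ≤ 1 → b + (m + m) ≡ c + (n + n) → b ≡ c × m ≡ n
bit+double-injective {b} {c} zero zero _ _ eq = trans (sym (+-identityʳ b)) (trans eq (+-identityʳ c)) , refl
bit+double-injective {b} {c} zero (suc n) b≤1 _ eq rewrite +-identityʳ b | eq | +-suc n n | +-suc c (suc (n + n)) | +-suc c (n + n) with s≤s () ← b≤1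
bit+double-injective {b} {c} (suc m) zero _ c≤1 eq rewrite +-identityʳ c | sym eq | +-suc m m | +-suc b (suc (m + m)) | +-suc b (m + m) with s≤s () ← c≤1
bit+double-injective {b} {c} (suc m) (suc n) b≤1 c≤1 eq
  rewrite +-suc m m | +-suc b (suc (m + m)) | +-suc b (m + m)
        | +-suc n n | +-suc c (suc (n + n)) | +-suc c (n + n)
  with b≡c , m≡n ← bit+double-injective m n b≤1 c≤1 (suc-injective (suc-injective eq)) = b≡c , cong suc m≡n

-- For each `x`, the multiplicity in `s ++ p ++ p` is a bit, coming from the distinct list `s`, plus
-- twice the multiplicity in `p`. Both can be read off from the total.
split-unique : ∀ {s t p q} → Unique s → Unique t → s ++ p ++ p ↭ t ++ q ++ q → s ↭ t × p ↭ q
split-unique {s} {t} {p} {q} s! t! eq = count-injective s t (proj₁ ∘ same) , count-injective p q (proj₂ ∘ same)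
  where
  count-join : ∀ x s p → count x (s ++ p ++ p) ≡ count x s + (count x p + count x p)
  count-join x s p = trans (count-++ x s (p ++ p)) (cong (count x s +_) (count-++ x p p))
  same : ∀ x → count x s ≡ count x t × count x p ≡ count x q
  same x = bit+double-injective (count x p) (count x q) (count-Unique x s!) (count-Unique x t!)
    (trans (sym (count-join x s p)) (trans (count-↭ x eq) (count-join x t q)))

-- Glaisher's bijection

double : ℕ → ℕ
double k = k * 2

odds evens halves : List ℕ → List ℕ
odds   = filter odd?
evens  = filter (2 ∣?_)
halves = map (_/ 2) ∘ evens

Even-double : ∀ k → Even (double k)
Even-double k = n∣m*n k

double-halves : ∀ ys → map double (halves ys) ≡ evens ys
double-halves ys = trans (sym (map-∘ (evens ys)))
  (map-id-local (All.map (λ { (divides k refl) → cong double (m*n/n≡m k 2) }) (All.all-filter (2 ∣?_) ys)))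

odds++double : ∀ {s} p → All Odd s → odds (s ++ map double p) ≡ s
odds++double {s} p s-odd = begin
  odds (s ++ map double p)        ≡⟨ filter-++ odd? s _ ⟩
  odds s ++ odds (map double p)   ≡⟨ cong₂ _++_ (filter-all odd? s-odd) (filter-none odd? none) ⟩
  s ++ []                         ≡⟨ ++-identityʳ s ⟩
  s                               ∎
  where
  open ≡-Reasoning
  none = All.map⁺ (All.tabulate {xs = p} λ {k} _ ¬even → ¬even (Even-double k))

halves++double : ∀ {s} p → All Odd s → halves (s ++ map double p) ≡ p
halves++double {s} p s-odd = begin
  halves (s ++ map double p)                        ≡⟨ cong (map (_/ 2)) (filter-++ (2 ∣?_) s _) ⟩
  map (_/ 2) (evens s ++ evens (map double p))      ≡⟨ cong (map (_/ 2)) (cong₂ _++_ (filter-none (2 ∣?_) s-odd) (filter-all (2 ∣?_) all)) ⟩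
  map (_/ 2) (map double p)                         ≡⟨ map-∘ p ⟨
  map (λ k → k * 2 / 2) p                           ≡⟨ map-id-local (All.tabulate λ {k} _ → m*n/n≡m k 2) ⟩
  p                                                 ∎
  where
  open ≡-Reasoning
  all = All.map⁺ (All.tabulate {xs = p} λ {k} _ → Even-double k)

odds++evens : ∀ ys → ys ↭ odds ys ++ map double (halves ys)
odds++evens ys = ↭-trans (filter-complement (2 ∣?_) ys) (↭-reflexive (cong (odds ys ++_) (sym (double-halves ys))))
  where
  filter-complement : ∀ {P : ℕ → Set} (P? : Decidable P) xs → xs ↭ filter (¬? ∘ P?) xs ++ filter P? xs
  filter-complement P? [] = ↭-refl
  filter-complement P? (x ∷ xs) with P? x
  ... | yes _ = ↭-trans (prep x (filter-complement P? xs)) (↭-sym (shift x (filter (¬? ∘ P?) xs) (filter P? xs)))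
  ... | no  _ = prep x (filter-complement P? xs)

-- A multiset of odd parts is S + 2T with S distinct, and a set of parts is
-- S ∪ double U with S odd, so the two correspond via T ↦ U recursively. The
-- first argument bounds the depth; any bound on the sum of the parts is enough.
toDistinct toOdd : ℕ → List ℕ → List ℕ
toDistinct zero    xs = []
toDistinct (suc f) xs = single ++ map double (toDistinct f half) where open Split (split xs)
toOdd zero    ys = []
toOdd (suc f) ys = odds ys ++ toOdd f (halves ys) ++ toOdd f (halves ys)

-- `split` works on a list and its output order depends on the input order, so invariance has to
-- come from `split-unique`.
toDistinct-↭ : ∀ f {xs ys} → xs ↭ ys → toDistinct f xs ↭ toDistinct f ys
toDistinct-↭ zero _ = ↭-refl
toDistinct-↭ (suc f) {xs} {ys} xs↭ys =
  let s↭ , p↭ = split-unique X.single-unique Y.single-unique (↭-trans (↭-sym X.↭-join) (↭-trans xs↭ys Y.↭-join))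
  in ++⁺ s↭ (map⁺ double (toDistinct-↭ f p↭))
  where
  module X = Split (split xs)
  module Y = Split (split ys)

toOdd-↭ : ∀ f {xs ys} → xs ↭ ys → toOdd f xs ↭ toOdd f ys
toOdd-↭ zero _ = ↭-refl
toOdd-↭ (suc f) xs↭ys = ++⁺ (filter-↭ odd? xs↭ys) (++⁺ ih ih)
  where ih = toOdd-↭ f (map⁺ (_/ 2) (filter-↭ (2 ∣?_) xs↭ys))

-- Positivity, sums and distinctness along Glaisher's recursion

Positive : List ℕ → Set
Positive = All (0 <_)

-- Justifies the value `[]` that both maps return at depth bound zero: there the input is empty
-- anyway.
positive-sum≤0 : ∀ {xs} → Positive xs → sum xs ≤ 0 → xs ≡ []
positive-sum≤0 [] _ = refl
positive-sum≤0 (s≤s _ ∷ _) ()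

-- Lets the depth bound drop by one per level: the recursive call is on a list whose sum counts
-- twice in the current sum.
m+m≤1+n⇒m≤n : ∀ m {n} → m + m ≤ suc n → m ≤ n
m+m≤1+n⇒m≤n zero _ = z≤n
m+m≤1+n⇒m≤n (suc m) (s≤s le) = ≤-trans (m≤n+m (suc m) m) le

sum-double : ∀ xs → sum (map double xs) ≡ sum xs + sum xs
sum-double xs = trans (go xs) (trans (*-comm (sum xs) 2) (cong (sum xs +_) (+-identityʳ _)))
  where
  go : ∀ xs → sum (map double xs) ≡ double (sum xs)
  go [] = refl
  go (x ∷ xs) = trans (cong (double x +_) (go xs)) (sym (*-distribʳ-+ 2 x (sum xs)))

sum-join : ∀ s p → sum (s ++ p ++ p) ≡ sum s + (sum p + sum p)
sum-join s p = trans (sum-++ s (p ++ p)) (cong (sum s +_) (sum-++ p p))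

module _ {xs : List ℕ} where
  open Split (split xs)

  All-single : ∀ {P : ℕ → Set} → All P xs → All P single
  All-single = All.++⁻ˡ single ∘ All-resp-↭ ↭-join

  All-half : ∀ {P : ℕ → Set} → All P xs → All P half
  All-half = All.++⁻ˡ half ∘ All.++⁻ʳ single ∘ All-resp-↭ ↭-join

  sum-split : sum xs ≡ sum single + (sum half + sum half)
  sum-split = trans (sum-↭ ↭-join) (sum-join single half)

  sum-half≤ : ∀ {f} → sum xs ≤ suc f → sum half ≤ f
  sum-half≤ le = m+m≤1+n⇒m≤n (sum half)
    (≤-trans (m≤n+m _ (sum single)) (≤-trans (≤-reflexive (sym sum-split)) le))

module _ {ys : List ℕ} where
  All-odds : ∀ {P : ℕ → Set} → All P ys → All P (odds ys)
  All-odds = All.filter⁺ odd?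

  sum-halves : sum ys ≡ sum (odds ys) + (sum (halves ys) + sum (halves ys))
  sum-halves = trans (sum-↭ (odds++evens ys)) (trans (sum-++ (odds ys) _) (cong (sum (odds ys) +_) (sum-double (halves ys))))

  sum-halves≤ : ∀ {f} → sum ys ≤ suc f → sum (halves ys) ≤ f
  sum-halves≤ le = m+m≤1+n⇒m≤n (sum (halves ys))
    (≤-trans (m≤n+m _ (sum (odds ys))) (≤-trans (≤-reflexive (sym sum-halves)) le))

  halves-positive : Positive ys → Positive (halves ys)
  halves-positive pos = All.map (λ {k} → *-cancelʳ-< 2 0 k)
    (All.map⁻ (subst Positive (sym (double-halves ys)) (All.filter⁺ (2 ∣?_) pos)))

  halves-unique : Unique ys → Unique (halves ys)
  halves-unique ys! = Unique.map⁻ (subst Unique (sym (double-halves ys)) (Unique.filter⁺ (2 ∣?_) ys!))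

-- `single` is odd and the doubled parts are even, so `odds` and `halves` recover the two pieces
-- exactly. By induction the second turns back into `half`, and `↭-join` reassembles `xs`.
toOdd-toDistinct : ∀ f {xs} → Positive xs → All Odd xs → sum xs ≤ f → toOdd f (toDistinct f xs) ↭ xs
toOdd-toDistinct zero pos _ le rewrite positive-sum≤0 pos le = ↭-refl
toOdd-toDistinct (suc f) {xs} pos odd le
  rewrite odds++double (toDistinct f (Split.half (split xs))) (All-single odd)
        | halves++double (toDistinct f (Split.half (split xs))) (All-single odd)
  = ↭-trans (++⁺ˡ single (++⁺ ih ih)) (↭-sym ↭-join)
  where
  open Split (split xs)
  ih = toOdd-toDistinct f (All-half pos) (All-half odd) (sum-half≤ {xs} le)

-- `toOdd (suc f) ys` already is a distinct list, `odds ys`, followed by a repeated list. By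
-- uniqueness of the splitting, `split` finds these same pieces up to order.
toDistinct-toOdd : ∀ f {ys} → Positive ys → Unique ys → sum ys ≤ f → toDistinct f (toOdd f ys) ↭ ys
toDistinct-toOdd zero pos _ le rewrite positive-sum≤0 pos le = ↭-refl
toDistinct-toOdd (suc f) {ys} pos ys! le =
  let s↭ , p↭ = split-unique single-unique (Unique.filter⁺ odd? ys!) (↭-sym ↭-join)
  in ↭-trans (++⁺ s↭ (map⁺ double (↭-trans (toDistinct-↭ f p↭) ih))) (↭-sym (odds++evens ys))
  where
  open Split (split (toOdd (suc f) ys))
  ih = toDistinct-toOdd f (halves-positive pos) (halves-unique ys!) (sum-halves≤ {ys} le)

toDistinct-positive : ∀ f {xs} → Positive xs → Positive (toDistinct f xs)
toDistinct-positive zero _ = []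
toDistinct-positive (suc f) pos =
  All.++⁺ (All-single pos) (All.map⁺ (All.map (λ {k} → *-monoˡ-< 2) (toDistinct-positive f (All-half pos))))

-- The parts in `single` are odd and the doubled ones even, so the two distinct pieces cannot
-- overlap.
toDistinct-unique : ∀ f {xs} → All Odd xs → Unique (toDistinct f xs)
toDistinct-unique zero _ = []
toDistinct-unique (suc f) {xs} odd =
  Unique.++⁺ single-unique (Unique.map⁺ (λ {m} {n} → *-cancelʳ-≡ m n 2) (toDistinct-unique f (All-half odd)))
    λ { (∈s , ∈d) → disjoint ∈s (∈-map⁻ double ∈d) }
  where
  open Split (split xs)
  disjoint = λ {v} (v∈s : v ∈ single) (v=2k : ∃[ k ] (k ∈ toDistinct f half × v ≡ double k)) →
    All.lookup (All-single odd) v∈s (subst Even (sym (proj₂ (proj₂ v=2k))) (Even-double (proj₁ v=2k)))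

sum-toDistinct : ∀ f {xs} → Positive xs → sum xs ≤ f → sum (toDistinct f xs) ≡ sum xs
sum-toDistinct zero pos le rewrite positive-sum≤0 pos le = refl
sum-toDistinct (suc f) {xs} pos le = begin
  sum (single ++ map double d)     ≡⟨ sum-++ single _ ⟩
  sum single + sum (map double d)  ≡⟨ cong (sum single +_) (sum-double d) ⟩
  sum single + (sum d + sum d)     ≡⟨ cong (λ m → sum single + (m + m)) ih ⟩
  sum single + (sum half + sum half) ≡⟨ sum-split {xs} ⟨
  sum xs                           ∎
  where
  open ≡-Reasoning
  open Split (split xs)
  d = toDistinct f half
  ih = sum-toDistinct f (All-half pos) (sum-half≤ {xs} le)

toOdd-positive : ∀ f {ys} → Positive ys → Positive (toOdd f ys)
toOdd-positive zero _ = []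
toOdd-positive (suc f) pos = All.++⁺ (All-odds pos) (All.++⁺ ih ih)
  where ih = toOdd-positive f (halves-positive pos)

toOdd-odd : ∀ f ys → All Odd (toOdd f ys)
toOdd-odd zero _ = []
toOdd-odd (suc f) ys = All.++⁺ (All.all-filter odd? ys) (All.++⁺ ih ih)
  where ih = toOdd-odd f (halves ys)

sum-toOdd : ∀ f {ys} → Positive ys → sum ys ≤ f → sum (toOdd f ys) ≡ sum ys
sum-toOdd zero pos le rewrite positive-sum≤0 pos le = refl
sum-toOdd (suc f) {ys} pos le = begin
  sum (odds ys ++ o ++ o)                                ≡⟨ sum-join (odds ys) o ⟩
  sum (odds ys) + (sum o + sum o)                        ≡⟨ cong (λ m → sum (odds ys) + (m + m)) ih ⟩
  sum (odds ys) + (sum (halves ys) + sum (halves ys))    ≡⟨ sum-halves {ys} ⟨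
  sum ys                                                 ∎
  where
  open ≡-Reasoning
  o = toOdd f (halves ys)
  ih = sum-toOdd f (halves-positive pos) (sum-halves≤ {ys} le)

-- Bijections between refinement types

-- The membership proofs are irrelevant, so the round-trip equations are available only
-- irrelevantly; decidable equality recomputes them.
refine-↔ : ∀ {A B : Set} {P : A → Set} {Q : B → Set} → DecidableEquality A → DecidableEquality B →
           (f : A → B) (g : B → A) → (∀ {x} → P x → Q (f x)) → (∀ {y} → Q y → P (g y)) →
           (∀ {x} → P x → g (f x) ≡ x) → (∀ {y} → Q y → f (g y) ≡ y) →
           Refinement A P ↔ Refinement B Q
refine-↔ _≟ᴬ_ _≟ᴮ_ f g f-pres g-pres g∘f f∘g = mk↔ₛ′
  (λ { (x , [ p ]) → f x , [ f-pres p ] })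
  (λ { (y , [ q ]) → g y , [ g-pres q ] })
  (λ { (y , [ q ]) → value-injective (recompute (f (g y) ≟ᴮ y) (f∘g q)) })
  (λ { (x , [ p ]) → value-injective (recompute (g (f x) ≟ᴬ x) (g∘f p)) })

refine-⊎ : ∀ {A : Set} {P Q R : A → Set} → (∀ x → Q x ⊎ R x) → (∀ {x} → Q x → R x → ⊥) →
           Refinement A P ↔ (Refinement A (λ x → P x × Q x) ⊎ Refinement A (λ x → P x × R x))
refine-⊎ {A} {P} {Q} {R} decide disjoint = mk↔ₛ′ to from to∘from from∘to
  where
  Summands = Refinement A (λ x → P x × Q x) ⊎ Refinement A (λ x → P x × R x)
  to : Refinement A P → Summands
  to (x , [ p ]) with decide x
  ... | inj₁ q = inj₁ (x , [ p , q ])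
  ... | inj₂ r = inj₂ (x , [ p , r ])
  from : Summands → Refinement A P
  from (inj₁ (x , [ pq ])) = x , [ proj₁ pq ]
  from (inj₂ (x , [ pr ])) = x , [ proj₁ pr ]
  to∘from : ∀ y → to (from y) ≡ y
  to∘from (inj₁ (x , [ pq ])) with decide x
  ... | inj₁ q = refl
  ... | inj₂ r = contradiction-irr (proj₂ pq) (λ q → disjoint q r)
  to∘from (inj₂ (x , [ pr ])) with decide x
  ... | inj₁ q = contradiction-irr (proj₂ pr) (disjoint q)
  ... | inj₂ r = refl
  from∘to : ∀ y → from (to y) ≡ y
  from∘to (x , [ p ]) with decide x
  ... | inj₁ q = refl
  ... | inj₂ r = refl

-- Finiteness of decidable refinement types

Unique⇒lookup-injective : ∀ {A : Set} {xs : List A} → Unique xs → ∀ {i j} → lookup xs i ≡ lookup xs j → i ≡ j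
Unique⇒lookup-injective (x∉ ∷ u) {zero}  {zero}  _  = refl
Unique⇒lookup-injective (x∉ ∷ u) {zero}  {suc j} eq = contradiction eq (All.lookup x∉ (∈-lookup j))
Unique⇒lookup-injective (x∉ ∷ u) {suc i} {zero}  eq = contradiction (sym eq) (All.lookup x∉ (∈-lookup i))
Unique⇒lookup-injective (x∉ ∷ u) {suc i} {suc j} eq = cong suc (Unique⇒lookup-injective u eq)

-- An element is numbered by its position in the filtered, duplicate-free list of candidates;
-- absence of duplicates makes the position unique.
refinement-finite : ∀ {A : Set} {P : A → Set} → DecidableEquality A → Decidable P →
                    (xs : List A) → (∀ {x} → P x → x ∈ xs) → ∃[ k ] HasCardinality (Refinement A P) k
refinement-finite {A} {P} _≟ᴬ_ P? xs complete = length ps , mk↔ₛ′ to from to∘from from∘to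
  where
  ps = filter P? (deduplicate _≟ᴬ_ xs)
  ps! : Unique ps
  ps! = Unique.filter⁺ P? (deduplicate-! _≟ᴬ_ xs)
  member : ∀ {x} → .(P x) → x ∈ ps
  member {x} p with p′ ← recompute (P? x) p = ∈-filter⁺ P? (∈-deduplicate⁺ _≟ᴬ_ (complete p′)) p′
  to : Refinement A P → Fin (length ps)
  to (x , [ p ]) = index (member p)
  from : Fin (length ps) → Refinement A P
  from i = lookup ps i , [ proj₂ (∈-filter⁻ P? {xs = deduplicate _≟ᴬ_ xs} (∈-lookup i)) ]
  to∘from : ∀ i → to (from i) ≡ i
  to∘from i = Unique⇒lookup-injective ps! (sym (lookup-index (member _)))
  from∘to : ∀ y → from (to y) ≡ y
  from∘to (x , [ p ]) = value-injective (sym (lookup-index (member p)))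

-- A deliberately crude search space: lists of length at most the first argument with entries below
-- the second. Irrelevant candidates are filtered out later.
listsBelow : ℕ → ℕ → List (List ℕ)
listsBelow zero    b = [] ∷ []
listsBelow (suc k) b = [] ∷ cartesianProductWith _∷_ (upTo b) (listsBelow k b)

∈-listsBelow : ∀ {k b xs} → length xs ≤ k → All (_< b) xs → xs ∈ listsBelow k b
∈-listsBelow {zero}  z≤n [] = here refl
∈-listsBelow {suc k} z≤n [] = here refl
∈-listsBelow {suc k} (s≤s le) (x<b ∷ xs<b) =
  there (∈-cartesianProductWith⁺ _∷_ (∈-upTo⁺ x<b) (∈-listsBelow le xs<b))

-- Pairs of partitions

Pair : Set
Pair = List ℕ × List ℕ

_≟ᴾ_ : DecidableEquality Pair
_≟ᴾ_ = ≡-decˣ (≡-decˡ _≟_) (≡-decˡ _≟_)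

IsPartition : List ℕ → Set
IsPartition xs = Linked _≥_ xs × Positive xs

-- In 𝓔 n a pair is (red , blue); for overpartitions it is (overlined , plain).
OddDistinctFirst OddFirst&Second : ℕ → Pair → Set
OddDistinctFirst n (xs , ys) =
  IsPartition xs × IsPartition ys × sum xs + sum ys ≡ n × Unique xs × All Odd xs
OddFirst&Second n π = OddDistinctFirst n π × All Odd (proj₂ π)

Parity : ℕ → Pair → Set
Parity i (xs , _) = length xs % 2 ≡ i

EPair OPair : ℕ → ℕ → Pair → Set
EPair i n π = (OddDistinctFirst n π × Unique (proj₂ π)) × Parity i π
OPair i n π = OddFirst&Second n π × Parity i π

OPair? : ∀ i n → Decidable (OPair i n)
OPair? i n (xs , ys) =
  ((partition? xs ×-dec partition? ys ×-dec (sum xs + sum ys ≟ n) ×-dec unique? xs ×-dec All.all? odd? xs)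
    ×-dec All.all? odd? ys) ×-dec (length xs % 2 ≟ i)
  where
  partition? : Decidable IsPartition
  partition? xs = Linked.linked? _≥?_ xs ×-dec All.all? (0 <?_) xs

OPair-finite : ∀ i n → ∃[ k ] HasCardinality (Refinement Pair (OPair i n)) k
OPair-finite i n = refinement-finite _≟ᴾ_ (OPair? i n) (cartesianProduct small small) complete
  where
  -- Positive parts with sum at most `n` number at most `n`, and each is below `suc n`.
  small = listsBelow n (suc n)
  length≤sum : ∀ {xs} → Positive xs → length xs ≤ sum xs
  length≤sum [] = z≤n
  length≤sum (x>0 ∷ pos) = +-mono-≤ x>0 (length≤sum pos)
  all≤sum : ∀ xs → All (_≤ sum xs) xs
  all≤sum [] = []
  all≤sum (x ∷ xs) = m≤m+n x (sum xs) ∷ All.map (λ le → ≤-trans le (m≤n+m (sum xs) x)) (all≤sum xs)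
  ∈-small : ∀ {xs} → Positive xs → sum xs ≤ n → xs ∈ small
  ∈-small {xs} pos le = ∈-listsBelow (≤-trans (length≤sum pos) le) (All.map (λ x≤ → s≤s (≤-trans x≤ le)) (all≤sum xs))
  complete : ∀ {π} → OPair i n π → π ∈ cartesianProduct small small
  complete {xs , ys} ((((_ , xs>0) , (_ , ys>0) , refl , _) , _) , _) =
    ∈-cartesianProduct⁺ (∈-small xs>0 (m≤m+n (sum xs) (sum ys))) (∈-small ys>0 (m≤n+m (sum ys) (sum xs)))

sorted-↭⇒≡ : ∀ {xs ys} → Linked _≥_ xs → Linked _≥_ ys → xs ↭ ys → xs ≡ ys
sorted-↭⇒≡ xs↗ ys↗ xs↭ys = Pointwise.Pointwise-≡⇒≡ (↗↭↗⇒≋ ≥-totalOrder xs↗ ys↗ (↭⇒↭ₛ xs↭ys))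

-- Only the second component changes, so the parity is kept, and its sum is at most `n`, which
-- therefore serves as depth bound. Sorting restores the canonical listing, which turns the
-- permutations into equalities.
EPair↔OPair : ∀ i n → Refinement Pair (EPair i n) ↔ Refinement Pair (OPair i n)
EPair↔OPair i n = refine-↔ _≟ᴾ_ _≟ᴾ_ f g f-pres g-pres g∘f f∘g
  where
  f g : Pair → Pair
  f (xs , ys) = xs , sort (toOdd n ys)
  g (xs , ys) = xs , sort (toDistinct n ys)
  bounded : ∀ xs ys → sum xs + sum ys ≡ n → sum ys ≤ n
  bounded xs ys refl = m≤n+m (sum ys) (sum xs)
  f-pres : ∀ {π} → EPair i n π → OPair i n (f π)
  f-pres {xs , ys} (((xs-part , (_ , pos) , size , xs! , xs-odd) , _) , parity) =
    ((xs-part , (sort-↗ _ , All-resp-↭ (↭-sym (sort-↭ _)) (toOdd-positive n pos)) ,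
      trans (cong (sum xs +_) (trans (sum-↭ (sort-↭ _)) (sum-toOdd n pos (bounded xs ys size)))) size , xs! , xs-odd) ,
     All-resp-↭ (↭-sym (sort-↭ _)) (toOdd-odd n ys)) , parity
  g-pres : ∀ {π} → OPair i n π → EPair i n (g π)
  g-pres {xs , ys} (((xs-part , (_ , pos) , size , xs! , xs-odd) , odd) , parity) =
    ((xs-part , (sort-↗ _ , All-resp-↭ (↭-sym (sort-↭ _)) (toDistinct-positive n pos)) ,
      trans (cong (sum xs +_) (trans (sum-↭ (sort-↭ _)) (sum-toDistinct n pos (bounded xs ys size)))) size , xs! , xs-odd) ,
     Unique-resp-↭ (↭-sym (sort-↭ _)) (toDistinct-unique n odd)) , parity
  g∘f : ∀ {π} → EPair i n π → g (f π) ≡ π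
  g∘f {xs , ys} (((_ , (ys↗ , pos) , size , _) , ys!) , _) = cong (xs ,_) (sorted-↭⇒≡ (sort-↗ _) ys↗
    (↭-trans (sort-↭ _) (↭-trans (toDistinct-↭ n (sort-↭ _)) (toDistinct-toOdd n pos ys! (bounded xs ys size)))))
  f∘g : ∀ {π} → OPair i n π → f (g π) ≡ π
  f∘g {xs , ys} (((_ , (ys↗ , pos) , size , _) , odd) , _) = cong (xs ,_) (sorted-↭⇒≡ (sort-↗ _) ys↗
    (↭-trans (sort-↭ _) (↭-trans (toOdd-↭ n (sort-↭ _)) (toOdd-toDistinct n pos odd (bounded xs ys size)))))

-- Toggling the overlining of the largest part

toggle : Pair → Pair
-- A default value: there is no part to move, which happens only for size 0.
toggle ([] , [])         = [] , []
toggle ([] , y ∷ ys)     = y ∷ [] , ys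
toggle (x ∷ xs , [])     = xs , x ∷ []
-- On a tie the overlining is removed, since overlining a second copy would break distinctness.
toggle (x ∷ xs , y ∷ ys) with y ≤? x
... | yes _ = xs , x ∷ y ∷ ys
... | no  _ = y ∷ x ∷ xs , ys

-- Says which component holds the part that toggle moves; a tie goes to the first.
data LargestPart : Pair → Set where
  first  : ∀ {x xs ys} → Linked _≥_ (x ∷ ys) → LargestPart (x ∷ xs , ys)
  second : ∀ {y xs ys} → All (_< y) xs → LargestPart (xs , y ∷ ys)

toggle-first : ∀ {x xs ys} → Linked _≥_ (x ∷ ys) → toggle (x ∷ xs , ys) ≡ (xs , x ∷ ys)
toggle-first [-] = refl
toggle-first {x} {ys = y ∷ _} (y≤x ∷ _) with y ≤? x
... | yes _  = refl
... | no y≰x = contradiction y≤x y≰x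

toggle-second : ∀ {y xs ys} → All (_< y) xs → toggle (xs , y ∷ ys) ≡ (y ∷ xs , ys)
toggle-second [] = refl
toggle-second {y} {x ∷ _} (x<y ∷ _) with y ≤? x
... | yes y≤x = contradiction y≤x (<⇒≱ x<y)
... | no _    = refl

≥⇒All≤ : ∀ {x xs} → Linked _≥_ (x ∷ xs) → All (_≤ x) xs
≥⇒All≤ = All.tail ∘ Linked⇒All (λ x≥y y≥z → ≤-trans y≥z x≥y) ≤-refl

All≤⇒≥ : ∀ {x xs} → All (_≤ x) xs → Linked _≥_ xs → Linked _≥_ (x ∷ xs)
All≤⇒≥ [] [] = [-]
All≤⇒≥ (y≤x ∷ _) xs↗ = y≤x ∷ xs↗

-- Once `x` has lost its overlining, this strictness ensures that the next toggle picks `x` again.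
strictly-decreasing : ∀ {x xs} → Linked _≥_ (x ∷ xs) → Unique (x ∷ xs) → All (_< x) xs
strictly-decreasing x↗ (x≢ ∷ _) = All.zipWith (λ { (z≤x , x≢z) → ≤∧≢⇒< z≤x (x≢z ∘ sym) }) (≥⇒All≤ x↗ , x≢)

-- This is where `0 < n` enters: it excludes the pair of empty partitions.
largestPart : ∀ {n π} → 0 < n → OddFirst&Second n π → LargestPart π
largestPart {π = [] , []} n>0 ((_ , _ , refl , _) , _) = contradiction n>0 λ ()
largestPart {π = [] , y ∷ ys} _ _ = second []
largestPart {π = x ∷ xs , []} _ _ = first [-]
largestPart {π = x ∷ xs , y ∷ ys} _ (((xs↗ , _) , (ys↗ , _) , _) , _) with y ≤? x
... | yes y≤x = first (y≤x ∷ ys↗)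
... | no  y≰x = second (≰⇒> y≰x ∷ All.map (λ z≤x → ≤-<-trans z≤x (≰⇒> y≰x)) (≥⇒All≤ xs↗))

module _ {n} (n>0 : 0 < n) where

  -- The moved part bounds every part of the list that receives it, so it can be put in front. When
  -- it becomes overlined the bound is strict, which keeps the overlined parts distinct.
  toggle-pres : ∀ {π} → OddFirst&Second n π → OddFirst&Second n (toggle π)
  toggle-pres o with largestPart n>0 o
  toggle-pres {x ∷ xs , ys} (((xs↗ , x>0 ∷ xs>0) , (ys↗ , ys>0) , size , x∉ ∷ xs! , x-odd ∷ xs-odd) , ys-odd)
    | first x≥ rewrite toggle-first {xs = xs} x≥ =
    ((Linked.tail xs↗ , xs>0) , (x≥ , x>0 ∷ ys>0) , trans (move x (sum xs) (sum ys)) size , xs! , xs-odd) , x-odd ∷ ys-odd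
    where
    move : ∀ a b c → b + (a + c) ≡ a + b + c
    move a b c = trans (sym (+-assoc b a c)) (cong (_+ c) (+-comm b a))
  toggle-pres {xs , y ∷ ys} (((xs↗ , xs>0) , (ys↗ , y>0 ∷ ys>0) , size , xs! , xs-odd) , y-odd ∷ ys-odd)
    | second xs< rewrite toggle-second {ys = ys} xs< =
    ((All≤⇒≥ (All.map <⇒≤ xs<) xs↗ , y>0 ∷ xs>0) , (Linked.tail ys↗ , ys>0) , trans (move y (sum xs) (sum ys)) size ,
      All.map (λ z<y y≡z → <⇒≢ z<y (sym y≡z)) xs< ∷ xs! , y-odd ∷ xs-odd) , ys-odd
    where
    move : ∀ a b c → a + b + c ≡ b + (a + c)
    move a b c = trans (cong (_+ c) (+-comm a b)) (+-assoc b a c)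

  -- The two cases undo each other. A part just moved to the second list strictly exceeds the
  -- remaining first list, and one just moved to the first list is at least every part left in the
  -- second.
  toggle-involutive : ∀ {π} → OddFirst&Second n π → toggle (toggle π) ≡ π
  toggle-involutive o with largestPart n>0 o
  toggle-involutive {x ∷ xs , ys} (((xs↗ , _) , _ , _ , xs! , _) , _) | first x≥ =
    trans (cong toggle (toggle-first x≥)) (toggle-second (strictly-decreasing xs↗ xs!))
  toggle-involutive {xs , y ∷ ys} ((_ , (ys↗ , _) , _) , _) | second xs< =
    trans (cong toggle (toggle-second xs<)) (toggle-first ys↗)

  toggle-parity : ∀ {π i j} → i + j ≡ 1 → OddFirst&Second n π → Parity i π → Parity j (toggle π)
  toggle-parity i+j o p with largestPart n>0 o
  toggle-parity {x ∷ xs , ys} i+j o p | first x≥ rewrite toggle-first {xs = xs} x≥ =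
    -- The residues of consecutive lengths sum to 1, as do `i` and `j`. The old residue is `i`, so
    -- cancelling it leaves `j`.
    +-cancelˡ-≡ _ _ _ (trans (trans (cong (_+ _) (sym p)) (flip (length xs))) (sym i+j))
    where
    flip : ∀ m → suc m % 2 + m % 2 ≡ 1
    flip zero = refl
    flip (suc zero) = refl
    flip (suc (suc m)) = flip m
  toggle-parity {xs , y ∷ ys} i+j o p | second xs< rewrite toggle-second {ys = ys} xs< =
    +-cancelˡ-≡ _ _ _ (trans (trans (cong (_+ _) (sym p)) (flip (length xs))) (sym i+j))
    where
    flip : ∀ m → m % 2 + suc m % 2 ≡ 1
    flip zero = refl
    flip (suc zero) = refl
    flip (suc (suc m)) = flip m

  OPair₀↔OPair₁ : Refinement Pair (OPair 0 n) ↔ Refinement Pair (OPair 1 n)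
  OPair₀↔OPair₁ = refine-↔ _≟ᴾ_ _≟ᴾ_ toggle toggle
    (λ { (o , p) → toggle-pres o , toggle-parity refl o p })
    (λ { (o , p) → toggle-pres o , toggle-parity refl o p })
    (toggle-involutive ∘ proj₁) (toggle-involutive ∘ proj₁)

-- Passing between the given types and pairs of lists

𝓔↔EPair : ∀ i n → [ π ∈ 𝓔 n ∣ r π % 2 ≡ i ] ↔ Refinement Pair (EPair i n)
𝓔↔EPair i n = mk↔ₛ′ to from (λ _ → refl) (λ _ → refl)
  where
  -- All red parts are odd, so `r` is just the number of red parts.
  redOdd : ∀ {xs} → All Odd xs → length (filter odd? xs) % 2 ≡ length xs % 2
  redOdd = cong (λ zs → length zs % 2) ∘ filter-all odd?
  to : [ π ∈ 𝓔 n ∣ r π % 2 ≡ i ] → Refinement Pair (EPair i n)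
  to ((mkTwoColour (xs , [ px ]) (ys , [ py ]) , [ e ]) , [ par ]) = (xs , ys) ,
    [ ((px , py , size≡n e , redDistinct e , noEvenRed e) , blueDistinct e) , trans (sym (redOdd (noEvenRed e))) par ]
    where open InE
  inE : ∀ {red blue} → EPair i n (parts red , parts blue) → InE n (mkTwoColour red blue)
  inE (((_ , _ , size , red! , red-odd) , blue!) , _) = record
    { size≡n = size ; redDistinct = red! ; blueDistinct = blue! ; noEvenRed = red-odd }
  from : Refinement Pair (EPair i n) → [ π ∈ 𝓔 n ∣ r π % 2 ≡ i ]
  from ((xs , ys) , [ e ]) =
    (mkTwoColour (xs , [ firstPart e ]) (ys , [ secondPart e ]) , [ inE e ]) , [ trans (redOdd (odd e)) (proj₂ e) ]
    where
    firstPart : EPair i n (xs , ys) → IsPartition xs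
    firstPart (((p , _) , _) , _) = p
    secondPart : EPair i n (xs , ys) → IsPartition ys
    secondPart (((_ , p , _) , _) , _) = p
    odd : EPair i n (xs , ys) → All Odd xs
    odd (((_ , _ , _ , _ , o) , _) , _) = o

OddOverpartition↔Pair : ∀ n → OddOverpartition n ↔ Refinement Pair (OddFirst&Second n)
OddOverpartition↔Pair n = mk↔ₛ′ to from (λ _ → refl) (λ _ → refl)
  where
  to : OddOverpartition n → Refinement Pair (OddFirst&Second n)
  to ((mkMarked (xs , [ px ]) (ys , [ py ]) , [ xs! ]) , [ o ]) = (xs , ys) ,
    [ (px , py , size≡n o , xs! , overlinedOdd o) , plainOdd o ]
    where open IsOddOverpartitionOf
  isOdd : ∀ {π} → OddFirst&Second n (MarkedPartition.overlinedParts (value π) , MarkedPartition.plainParts (value π)) →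
          IsOddOverpartitionOf n π
  isOdd ((_ , _ , size , _ , xs-odd) , ys-odd) = record
    { size≡n = size ; overlinedOdd = xs-odd ; plainOdd = ys-odd }
  from : Refinement Pair (OddFirst&Second n) → OddOverpartition n
  from ((xs , ys) , [ o ]) = (mkMarked (xs , [ proj₁ (proj₁ o) ]) (ys , [ proj₁ (proj₂ (proj₁ o)) ]) , [ distinct o ]) , [ isOdd o ]
    where
    distinct : OddFirst&Second n (xs , ys) → Unique xs
    distinct ((_ , _ , _ , xs! , _) , _) = xs!


-- Counting both parity classes and their union

parity : ∀ π → Parity 0 π ⊎ Parity 1 π
parity (xs , _) = go (length xs)
  where
  go : ∀ m → m % 2 ≡ 0 ⊎ m % 2 ≡ 1
  go zero = inj₁ refl
  go (suc zero) = inj₂ refl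
  go (suc (suc m)) = go m

theorem1p11 : ∀ (n : ℕ) → 0 < n →
    ∃[ E₀ ] ∃[ E₁ ] ∃[ p̄ₒ ]
    (HasCardinality (𝓔₀ n) E₀ ×
    HasCardinality (𝓔₁ n) E₁ ×
    HasCardinality (OddOverpartition n) p̄ₒ ×
    E₀ ≡ E₁ ×
    2 * E₁ ≡ p̄ₒ)
theorem1p11 n n>0 =
  let k , O₁↔k = OPair-finite 1 n
      O₀↔k = O₁↔k ↔-∘ OPair₀↔OPair₁ n>0
  -- `k` counts the odd overpartitions with an odd number of overlined parts; toggling transfers the
  -- count to the even class.
  in k , k , k + k ,
     (𝓔₀ n                        ↔⟨ 𝓔↔EPair 0 n ⟩
      Refinement Pair (EPair 0 n) ↔⟨ EPair↔OPair 0 n ⟩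
      Refinement Pair (OPair 0 n) ↔⟨ O₀↔k ⟩
      Fin k                       ∎) ,
     (𝓔₁ n                        ↔⟨ 𝓔↔EPair 1 n ⟩
      Refinement Pair (EPair 1 n) ↔⟨ EPair↔OPair 1 n ⟩
      Refinement Pair (OPair 1 n) ↔⟨ O₁↔k ⟩
      Fin k                       ∎) ,
     (OddOverpartition n                     ↔⟨ OddOverpartition↔Pair n ⟩
      Refinement Pair (OddFirst&Second n)    ↔⟨ refine-⊎ parity (λ p q → 0≢1+n (trans (sym p) q)) ⟩
      (Refinement Pair (OPair 0 n) ⊎ Refinement Pair (OPair 1 n)) ↔⟨ O₀↔k ⊎-↔ O₁↔k ⟩
      (Fin k ⊎ Fin k)                        ↔⟨ +↔⊎ ⟨
      Fin (k + k)                            ∎) ,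
     refl ,
     -- `2 * k` computes to `k + (k + 0)`.
     cong (k +_) (+-identityʳ k)
  where open EquationalReasoning
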